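{- The hierarchy $(\mathrm{FO}_q)_{q\in\mathbb N}$ is strict on arithmetical structures: there is a finite relational vocabulary $\tau\supseteq\{<,+,\times\}$ such that for every $q\in\mathbb N$ there is a first-order $\tau$-sentence of quantifier rank at most $q+1$ which is not equivalent, on the class of all finite $\tau$-structures with built-in addition and multiplication, to any first-order $\tau$-sentence of quantifier rank at most $q$.
   Context: For $n\in\mathbb N$ let $[n]=\{0,\dots,n-1\}$ with natural order $<^{[n]}$, $+^{[n]}=\{(a,b,c)\in[n]^3:c=a+b\}$, $\times^{[n]}=\{(a,b,c)\in[n]^3:c=ab\}$. A finite $\tau$-structure ($<$ binary, $+,\times$ ternary) has built-in addition and multiplication if its $\{<,+,\times\}$-reduct is isomorphic to $([n],<^{[n]},+^{[n]},\times^{[n]})$ with $n$ its size. $\mathrm{FO}_q$ denotes first-order sentences of quantifier rank at most $q$. -}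

module Defs where

open import Data.Nat using (ℕ; zero; suc; _+_; _*_; _<_; _⊔_)
open import Data.Fin using (Fin; toℕ)
open import Data.Fin.Base using () renaming (zero to fz; suc to fs)
open import Data.Fin.Properties using (_≟_)
open import Data.Vec using (Vec; []; _∷_; lookup; map)
open import Data.Bool using (Bool; true; false; not; _∧_; _∨_; T)
open import Data.List using (List; allFin)
open import Data.Bool.ListAction using (any; all)
open import Data.Product using (Σ; _×_)
open import Relation.Nullary.Decidable using (⌊_⌋)
open import Relation.Binary.PropositionalEquality using (_≡_)
open import Function.Bundles using (_⇔_)
open import Function.Definitions using (Bijective)

-- A finite relational vocabulary τ ⊇ {<,+,×}:
-- the three arithmetic symbols (< binary, +,× ternary) together with
-- m further relation symbols, the i-th one of arity (ar i).
-- The vocabulary is represented by the arity function ar : Fin m → ℕ.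

data Formula {m : ℕ} (ar : Fin m → ℕ) : ℕ → Set where
  eq   : ∀ {k} → Fin k → Fin k → Formula ar k
  lt   : ∀ {k} → Fin k → Fin k → Formula ar k
  add  : ∀ {k} → Fin k → Fin k → Fin k → Formula ar k
  mul  : ∀ {k} → Fin k → Fin k → Fin k → Formula ar k
  rel  : ∀ {k} (s : Fin m) → Vec (Fin k) (ar s) → Formula ar k
  neg  : ∀ {k} → Formula ar k → Formula ar k
  conj : ∀ {k} → Formula ar k → Formula ar k → Formula ar k
  disj : ∀ {k} → Formula ar k → Formula ar k → Formula ar k
  ex   : ∀ {k} → Formula ar (suc k) → Formula ar k
  fa   : ∀ {k} → Formula ar (suc k) → Formula ar k

Sentence : ∀ {m} → (Fin m → ℕ) → Set
Sentence ar = Formula ar 0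

qr : ∀ {m} {ar : Fin m → ℕ} {k} → Formula ar k → ℕ
qr (eq _ _)     = 0
qr (lt _ _)     = 0
qr (add _ _ _)  = 0
qr (mul _ _ _)  = 0
qr (rel _ _)    = 0
qr (neg φ)      = qr φ
qr (conj φ ψ)   = qr φ ⊔ qr ψ
qr (disj φ ψ)   = qr φ ⊔ qr ψ
qr (ex φ)       = suc (qr φ)
qr (fa φ)       = suc (qr φ)

record Structure {m : ℕ} (ar : Fin m → ℕ) (n : ℕ) : Set where
  field
    ltA  : Fin n → Fin n → Bool
    addA : Fin n → Fin n → Fin n → Bool
    mulA : Fin n → Fin n → Fin n → Bool
    relA : (s : Fin m) → Vec (Fin n) (ar s) → Bool
open Structure public

eval : ∀ {m} {ar : Fin m → ℕ} {n k} → Structure ar n → Formula ar k → Vec (Fin n) k → Bool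
eval A (eq x y)    ρ = ⌊ lookup ρ x ≟ lookup ρ y ⌋
eval A (lt x y)    ρ = ltA A (lookup ρ x) (lookup ρ y)
eval A (add x y z) ρ = addA A (lookup ρ x) (lookup ρ y) (lookup ρ z)
eval A (mul x y z) ρ = mulA A (lookup ρ x) (lookup ρ y) (lookup ρ z)
eval A (rel s xs)  ρ = relA A s (map (lookup ρ) xs)
eval A (neg φ)     ρ = not (eval A φ ρ)
eval A (conj φ ψ)  ρ = eval A φ ρ ∧ eval A ψ ρ
eval A (disj φ ψ)  ρ = eval A φ ρ ∨ eval A ψ ρ
eval {n = n} A (ex φ) ρ = any (λ a → eval A φ (a ∷ ρ)) (allFin n)
eval {n = n} A (fa φ) ρ = all (λ a → eval A φ (a ∷ ρ)) (allFin n)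

_⊨_ : ∀ {m} {ar : Fin m → ℕ} {n} → Structure ar n → Sentence ar → Set
A ⊨ φ = T (eval A φ [])

BuiltInArith : ∀ {m} {ar : Fin m → ℕ} {n} → Structure ar n → Set
BuiltInArith {n = n} A =
  Σ (Fin n → Fin n) λ h →
    Bijective _≡_ _≡_ h
    × (∀ a b → T (ltA A a b) ⇔ (toℕ (h a) < toℕ (h b)))
    × (∀ a b c → T (addA A a b c) ⇔ (toℕ (h c) ≡ toℕ (h a) + toℕ (h b)))
    × (∀ a b c → T (mulA A a b c) ⇔ (toℕ (h c) ≡ toℕ (h a) * toℕ (h b)))

-- φ and ψ are equivalent on the class of all finite τ-structures with
-- built-in addition and multiplication (structures are nonempty: size suc n).
EquivArith : ∀ {m} {ar : Fin m → ℕ} → Sentence ar → Sentence ar → Set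
EquivArith {ar = ar} φ ψ =
  ∀ (n : ℕ) (A : Structure ar (suc n)) → BuiltInArith A → (A ⊨ φ ⇔ A ⊨ ψ)

{-# OPTIONS --safe #-}

-- The proof is by counting.  On a universe with standard arithmetic, the
-- number of rank-q types of structures is at most a q-fold exponential of 2^a,
-- where a is the number of atoms in q variables; this is polynomial in q, and
-- addition and multiplication matter only through their contribution to it.
-- On the other hand, let the universe contain hereditary sets of levels
-- 0,…,q, where a set of level 0 is a set of atoms R_s(y_j, y_0) on a
-- descending membership chain y_q ∋ … ∋ y_0.  Quantifying along
-- such chains, sentences of rank q + 1 tell apart all sets S of elements of
-- level q.  The number of these S is a (q+1)-fold exponential of
-- 2^(3(q+1)) > a, so by the pigeonhole principle two of them have the same
-- rank-q type.

module Submission where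

open import Defs
open import Data.Bool using (Bool; true; false; not; _∧_; _∨_; T)
open import Data.Bool.Properties using (T-≡; T-∧; ⇔→≡) renaming (_≟_ to _≟ᵇ_)
open import Data.Bool.ListAction using (any; all)
open import Data.Fin using (Fin; zero; suc; toℕ; fromℕ<; combine; remQuot; finToFun; funToFin)
open import Data.Fin.Properties using (_≟_; any?; pigeonhole; toℕ<n; toℕ-fromℕ<; toℕ-combine; remQuot-combine; combine-remQuot; finToFun-funToFin; ¬∀⟶∃¬; 2↔Bool; +↔⊎; *↔×; <⇒≢; toℕ-injective)
open import Data.List using (allFin)
open import Data.List.Membership.Propositional using (lose)
open import Data.List.Membership.Propositional.Properties using (∈-allFin)
open import Data.List.Relation.Unary.All using (universal) renaming (lookup to All-lookup)
open import Data.List.Relation.Unary.All.Properties using (all⁺; all⁻)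
open import Data.List.Relation.Unary.Any using (satisfied)
open import Data.List.Relation.Unary.Any.Properties using (any⁺; any⁻)
open import Data.Nat using (ℕ; zero; suc; _+_; _*_; _^_; _≤_; _<_; _≡ᵇ_; ⌊_/2⌋; z≤n; s≤s; z<s; s<s; s<s⁻¹; _<?_) renaming (_≟_ to _≟ℕ_)
open import Data.Nat.Properties using (≤-refl; ≤-reflexive; ≤-trans; <⇒≤; +-suc; +-identityʳ; m≤m+n; m≤n+m; *-monoʳ-≤; *-comm; ^-monoˡ-≤; ^-monoʳ-<; ^-*-assoc; ⊔-lub; m⊔n≤o⇒m≤o; m⊔n≤o⇒n≤o; suc-injective; ≡ᵇ⇒≡; ≡⇒≡ᵇ; module ≤-Reasoning)
open import Data.Nat.Solver using (module +-*-Solver)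
open import Data.Product using (Σ; ∃; _×_; _,_; proj₁; proj₂)
open import Data.Product.Function.NonDependent.Propositional using (_×-↔_)
open import Data.Sum using (_⊎_; inj₁; inj₂)
open import Data.Sum.Function.Propositional using (_⊎-↔_)
open import Data.Vec using (Vec; []; _∷_; lookup)
open import Function using (_∘_; id)
open import Function.Bundles using (_⇔_; mk⇔; _↔_; Equivalence; Inverse)
open import Function.Properties.Inverse using (↔-refl; ↔-trans)
open import Relation.Binary.PropositionalEquality using (_≡_; _≢_; refl; sym; trans; cong; cong₂; subst; module ≡-Reasoning)
open import Relation.Nullary using (¬_; contradiction)
open import Relation.Nullary.Decidable using (⌊_⌋; toWitness; fromWitness)

-- Boolean truth values and quantification over `Fin n`.

T-ext : ∀ {x y} → (T x → T y) → (T y → T x) → x ≡ y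
T-ext f g = ⇔→≡ (mk⇔ (to T-≡ ∘ f ∘ from T-≡) (to T-≡ ∘ g ∘ from T-≡))
  where open Equivalence

module _ {n : ℕ} {p : Fin n → Bool} where

  any-allFin⁻ : T (any p (allFin n)) → ∃ λ a → T (p a)
  any-allFin⁻ = satisfied ∘ any⁻ p (allFin n)

  any-allFin⁺ : ∀ a → T (p a) → T (any p (allFin n))
  any-allFin⁺ a = any⁺ p ∘ lose (∈-allFin a)

  all-allFin⁻ : T (all p (allFin n)) → ∀ a → T (p a)
  all-allFin⁻ pf a = All-lookup (all⁺ p (allFin n) pf) (∈-allFin a)

  all-allFin⁺ : (∀ a → T (p a)) → T (all p (allFin n))
  all-allFin⁺ f = all⁻ p (universal f (allFin n))

-- The vocabulary: membership E, a predicate P (evaluated on the diagonal so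
-- that all symbols are binary), and R₀, R₁, R₂.

arity : Fin 5 → ℕ
arity _ = 2

pattern E   = zero
pattern P   = suc zero
pattern R s = suc (suc s)

-- Binary expansions

odd : ℕ → Bool
odd 0             = false
odd 1             = true
odd (suc (suc n)) = odd n

-- Ackermann coding: `v` stands for the finite set of all `u` with `bit v u`.
bit : ℕ → ℕ → Bool
bit v zero    = odd v
bit v (suc u) = bit ⌊ v /2⌋ u

⌊n/2⌋<m : ∀ n m → n < 2 * m → ⌊ n /2⌋ < m
⌊n/2⌋<m zero          (suc m) _ = z<s
⌊n/2⌋<m (suc zero)    (suc m) _ = z<s
⌊n/2⌋<m (suc (suc n)) (suc m) n<2m rewrite +-suc m (m + 0) =
  s<s (⌊n/2⌋<m n m (s<s⁻¹ (s<s⁻¹ n<2m)))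

odd-⌊n/2⌋-injective : ∀ v w → odd v ≡ odd w → ⌊ v /2⌋ ≡ ⌊ w /2⌋ → v ≡ w
odd-⌊n/2⌋-injective 0             0             _  _ = refl
odd-⌊n/2⌋-injective 1             1             _  _ = refl
odd-⌊n/2⌋-injective 0             1             () _
odd-⌊n/2⌋-injective 1             0             () _
odd-⌊n/2⌋-injective 0             (suc (suc w)) _  ()
odd-⌊n/2⌋-injective 1             (suc (suc w)) _  ()
odd-⌊n/2⌋-injective (suc (suc v)) 0             _  ()
odd-⌊n/2⌋-injective (suc (suc v)) 1             _  ()
odd-⌊n/2⌋-injective (suc (suc v)) (suc (suc w)) e h =
  cong (λ n → suc (suc n)) (odd-⌊n/2⌋-injective v w e (suc-injective h))

bit-injective : ∀ b {v w} → v < 2 ^ b → w < 2 ^ b →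
                (∀ (u : Fin b) → bit v (toℕ u) ≡ bit w (toℕ u)) → v ≡ w
bit-injective zero    (s≤s z≤n) (s≤s z≤n) _ = refl
bit-injective (suc b) {v} {w} v< w< e =
  odd-⌊n/2⌋-injective v w (e zero)
    (bit-injective b (⌊n/2⌋<m v (2 ^ b) v<) (⌊n/2⌋<m w (2 ^ b) w<) (e ∘ suc))

-- Halving `v` lowers `b` and `u` together. This bounds the values of the members of a coded set.
bit⇒< : ∀ b {v} u → v < 2 ^ b → T (bit v u) → u < b
bit⇒< zero    zero    (s≤s z≤n) ()
bit⇒< zero    (suc u) (s≤s z≤n) t = contradiction (bit⇒< zero u (s≤s z≤n) t) λ ()
bit⇒< (suc b) zero    _         _ = z<s
bit⇒< (suc b) {v} (suc u) v<    t = s<s (bit⇒< b u (⌊n/2⌋<m v (2 ^ b) v<) t)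

-- Counting

-- Here `r` counts the quantifiers, or set levels, still to come and `k` the variables in use; each
-- step adds one variable and one exponential.
tower : (ℕ → ℕ) → ℕ → ℕ → ℕ
tower f zero    k = f k
tower f (suc r) k = 2 ^ tower f r (suc k)

2^-mono-< : ∀ {m n} → m < n → 2 ^ m < 2 ^ n
2^-mono-< = ^-monoʳ-< 2 (s<s z<s)

n<2^n : ∀ n → n < 2 ^ n
n<2^n zero    = z<s
n<2^n (suc n) = begin-strict
  suc n            ≤⟨ n<2^n n ⟩
  2 ^ n            <⟨ 2^-mono-< {n} ≤-refl ⟩
  2 ^ suc n        ∎
  where open ≤-Reasoning

-- The seven binary predicates are equality, `<` and the five symbols of `arity`; the two ternary
-- ones are addition and multiplication.
#atoms : ℕ → ℕ
#atoms k = 7 * (k * k) + 2 * (k * (k * k))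

#types : ℕ → ℕ → ℕ
#types = tower (λ k → 2 ^ #atoms k)

-- The base counts the atoms R_s(y_j, y_0) for three `s` and `k` values of `j`. A set one level
-- higher has a bit for each possible code of a member.
#bits : ℕ → ℕ → ℕ
#bits = tower (3 *_)

#atoms<2^#bits : ∀ k → #atoms k < 2 ^ (3 * suc k)
#atoms<2^#bits k = begin
  -- The summand is the exact difference to (2(k + 1))^3. The cube is available because there are
  -- three symbols R_s.
  suc (#atoms k)                                                 ≤⟨ m≤m+n _ (6 * (k * (k * k)) + 17 * (k * k) + 24 * k + 7) ⟩
  suc (#atoms k) + (6 * (k * (k * k)) + 17 * (k * k) + 24 * k + 7) ≡⟨ expand k ⟩
  (2 * suc k) ^ 3                                                ≤⟨ ^-monoˡ-≤ 3 (*-monoʳ-≤ 2 (n<2^n k)) ⟩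
  (2 ^ suc k) ^ 3                                                ≡⟨ ^-*-assoc 2 (suc k) 3 ⟩
  2 ^ (suc k * 3)                                                ≡⟨ cong (2 ^_) (*-comm (suc k) 3) ⟩
  2 ^ (3 * suc k)                                                ∎
  where
  open ≤-Reasoning
  open +-*-Solver
  expand : ∀ k → suc (#atoms k) + (6 * (k * (k * k)) + 17 * (k * k) + 24 * k + 7) ≡ (2 * suc k) ^ 3
  expand = solve 1 (λ k →
    con 1 :+ (con 7 :* (k :* k) :+ con 2 :* (k :* (k :* k)))
      :+ (con 6 :* (k :* (k :* k)) :+ con 17 :* (k :* k) :+ con 24 :* k :+ con 7)
    := (con 2 :* (con 1 :+ k)) :^ 3) refl

-- Both towers grow by the same recursion, so everything rests on the base case; the extra
-- exponential on the right comes from S lying one level above its members.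
#types<2^#bits : ∀ r k → #types r k < 2 ^ #bits (suc r) k
#types<2^#bits zero    k = 2^-mono-< (#atoms<2^#bits k)
#types<2^#bits (suc r) k = 2^-mono-< (#types<2^#bits r (suc k))

-- Rank-r types

code : ∀ {m} → (Fin m → Bool) → Fin (2 ^ m)
code f = funToFin (Inverse.from 2↔Bool ∘ f)

code-injective : ∀ {m} (f g : Fin m → Bool) → code f ≡ code g → ∀ i → f i ≡ g i
code-injective f g e i = begin
  f i                              ≡⟨ decode f ⟨
  to (finToFun (code f) i)         ≡⟨ cong (λ c → to (finToFun c i)) e ⟩
  to (finToFun (code g) i)         ≡⟨ decode g ⟩
  g i                              ∎
  where
  open ≡-Reasoning
  open Inverse 2↔Bool using (to; from; strictlyInverseˡ)
  decode : ∀ h → to (finToFun (code h) i) ≡ h i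
  decode h = trans (cong to (finToFun-funToFin (from ∘ h) i)) (strictlyInverseˡ (h i))

Atom : ℕ → Set
Atom k = (Fin 7 × Fin k × Fin k) ⊎ (Fin 2 × Fin k × Fin k × Fin k)

Fin↔Atom : ∀ k → Fin (#atoms k) ↔ Atom k
Fin↔Atom k = ↔-trans +↔⊎
  (↔-trans *↔× (↔-refl ×-↔ *↔×)
   ⊎-↔ ↔-trans *↔× (↔-refl ×-↔ ↔-trans *↔× (↔-refl ×-↔ *↔×)))

atom : ∀ {k} → Atom k → Formula arity k
atom (inj₁ (zero        , x , y))     = eq x y
atom (inj₁ (suc zero    , x , y))     = lt x y
atom (inj₁ (suc (suc s) , x , y))     = rel s (x ∷ y ∷ [])
atom (inj₂ (zero        , x , y , z)) = add x y z
atom (inj₂ (suc zero    , x , y , z)) = mul x y z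

wk : ∀ {k} → Atom k → Atom (suc k)
wk (inj₁ (s , x , y))     = inj₁ (s , suc x , suc y)
wk (inj₂ (s , x , y , z)) = inj₂ (s , suc x , suc y , suc z)

eval-wk : ∀ {n k} (A : Structure arity n) (α : Atom k) a (ρ : Vec (Fin n) k) →
          eval A (atom (wk α)) (a ∷ ρ) ≡ eval A (atom α) ρ
eval-wk A (inj₁ (zero        , _)) a ρ = refl
eval-wk A (inj₁ (suc zero    , _)) a ρ = refl
eval-wk A (inj₁ (suc (suc s) , _)) a ρ = refl
eval-wk A (inj₂ (zero        , _)) a ρ = refl
eval-wk A (inj₂ (suc zero    , _)) a ρ = refl

-- The rank-0 type is the set of true atoms; the next rank collects the types of all one-point
-- extensions, as in Ehrenfeucht-Fraïssé games. Coding in `Fin` prepares for the pigeonhole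
-- principle.
type : ∀ {n} r {k} → Structure arity n → Vec (Fin n) k → Fin (#types r k)
type zero    {k} A ρ = code λ i → eval A (atom (Inverse.to (Fin↔Atom k) i)) ρ
type (suc r) {k} A ρ = code λ t → ⌊ any? (λ a → type r A (a ∷ ρ) ≟ t) ⌋

type-forth : ∀ {n} r {k} (A B : Structure arity n) {ρ σ : Vec (Fin n) k} →
             type (suc r) A ρ ≡ type (suc r) B σ →
             ∀ a → ∃ λ b → type r A (a ∷ ρ) ≡ type r B (b ∷ σ)
type-forth r A B {ρ} {σ} e a
  with toWitness (subst T (code-injective _ _ e (type r A (a ∷ ρ))) (fromWitness (a , refl)))
... | b , eq′ = b , sym eq′

-- Types of positive rank do not list atoms directly. These are read off from an arbitrary
-- extension, here by `zero`, which exists in a nonempty universe.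
type⇒atom : ∀ {n} r {k} (A B : Structure arity (suc n)) {ρ σ : Vec (Fin (suc n)) k} →
            type r A ρ ≡ type r B σ → ∀ α → eval A (atom α) ρ ≡ eval B (atom α) σ
type⇒atom zero {k} A B {ρ} {σ} e α =
  subst (λ β → eval A (atom β) ρ ≡ eval B (atom β) σ) (strictlyInverseˡ α)
        (code-injective _ _ e (from α))
  where open Inverse (Fin↔Atom k)
type⇒atom (suc r) A B {ρ} {σ} e α with type-forth r A B e zero
... | b , eq′ = begin
  eval A (atom α) ρ                 ≡⟨ eval-wk A α zero ρ ⟨
  eval A (atom (wk α)) (zero ∷ ρ)   ≡⟨ type⇒atom r A B eq′ (wk α) ⟩
  eval B (atom (wk α)) (b ∷ σ)      ≡⟨ eval-wk B α b σ ⟩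
  eval B (atom α) σ                 ∎
  where open ≡-Reasoning

type⇒eval : ∀ {n k} (φ : Formula arity k) r (A B : Structure arity (suc n))
            {ρ σ : Vec (Fin (suc n)) k} → qr φ ≤ r →
            type r A ρ ≡ type r B σ → eval A φ ρ ≡ eval B φ σ
type⇒eval (eq x y)    r A B _ t = type⇒atom r A B t (inj₁ (zero , x , y))
type⇒eval (lt x y)    r A B _ t = type⇒atom r A B t (inj₁ (suc zero , x , y))
type⇒eval (add x y z) r A B _ t = type⇒atom r A B t (inj₂ (zero , x , y , z))
type⇒eval (mul x y z) r A B _ t = type⇒atom r A B t (inj₂ (suc zero , x , y , z))
type⇒eval (rel s (x ∷ y ∷ [])) r A B _ t = type⇒atom r A B t (inj₁ (suc (suc s) , x , y))
type⇒eval (neg φ)     r A B q≤r t = cong not (type⇒eval φ r A B q≤r t)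
type⇒eval (conj φ ψ)  r A B q≤r t =
  cong₂ _∧_ (type⇒eval φ r A B (m⊔n≤o⇒m≤o (qr φ) (qr ψ) q≤r) t)
            (type⇒eval ψ r A B (m⊔n≤o⇒n≤o (qr φ) (qr ψ) q≤r) t)
type⇒eval (disj φ ψ)  r A B q≤r t =
  cong₂ _∨_ (type⇒eval φ r A B (m⊔n≤o⇒m≤o (qr φ) (qr ψ) q≤r) t)
            (type⇒eval ψ r A B (m⊔n≤o⇒n≤o (qr φ) (qr ψ) q≤r) t)
type⇒eval (ex φ) (suc r) A B (s≤s q≤r) t = T-ext (half A B t) (half B A (sym t))
  where
  half : ∀ A B {ρ σ} → type (suc r) A ρ ≡ type (suc r) B σ →
         T (eval A (ex φ) ρ) → T (eval B (ex φ) σ)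
  half A B t ∃φ with any-allFin⁻ ∃φ
  ... | a , φa with type-forth r A B t a
  ... | b , t′ = any-allFin⁺ b (subst T (type⇒eval φ r A B q≤r t′) φa)
type⇒eval (fa φ) (suc r) A B (s≤s q≤r) t = T-ext (half A B t) (half B A (sym t))
  where
  half : ∀ A B {ρ σ} → type (suc r) A ρ ≡ type (suc r) B σ →
         T (eval A (fa φ) ρ) → T (eval B (fa φ) σ)
  -- The back move: an element `b` of `B` is answered by some `a` of `A`.
  half A B t ∀φ = all-allFin⁺ λ b → let (a , t′) = type-forth r B A (sym t) b in
    subst T (sym (type⇒eval φ r B A q≤r t′)) (all-allFin⁻ ∀φ a)

-- Formulas for hereditary sets

lit : ∀ {k} → Bool → Formula arity k → Formula arity k
lit true  φ = φ
lit false φ = neg φ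

-- A variable must be in scope to write a quantifier-free truth for the empty conjunction.
⋀ : ∀ {b k} → (Fin b → Formula arity (suc k)) → Formula arity (suc k)
⋀ {zero}  φ = eq zero zero
⋀ {suc b} φ = conj (φ zero) (⋀ (φ ∘ suc))

module _ {n : ℕ} (A : Structure arity n) where

  eval-lit : ∀ {k} c (φ : Formula arity k) ρ → T (eval A (lit c φ) ρ) ⇔ eval A φ ρ ≡ c
  eval-lit true  φ ρ = T-≡
  eval-lit false φ ρ with eval A φ ρ
  ... | true  = mk⇔ (λ ()) (λ ())
  ... | false = mk⇔ (λ _ → refl) _

  eval-⋀ : ∀ {b k} (φ : Fin b → Formula arity (suc k)) ρ →
           T (eval A (⋀ φ) ρ) ⇔ (∀ u → T (eval A (φ u) ρ))
  eval-⋀ {zero}  φ ρ = mk⇔ (λ _ ()) (λ _ → fromWitness refl)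
  eval-⋀ {suc b} φ ρ = mk⇔
    (λ t → λ { zero    → proj₁ (to T-∧ t)
             ; (suc u) → to (eval-⋀ (φ ∘ suc) ρ) (proj₂ (to T-∧ t)) u })
    (λ f → from T-∧ (f zero , from (eval-⋀ (φ ∘ suc) ρ) (f ∘ suc)))
    where open Equivalence

qr-lit : ∀ {k} c (φ : Formula arity k) → qr (lit c φ) ≡ qr φ
qr-lit true  φ = refl
qr-lit false φ = refl

qr-⋀ : ∀ {b k r} (φ : Fin b → Formula arity (suc k)) → (∀ u → qr (φ u) ≤ r) → qr (⋀ φ) ≤ r
qr-⋀ {zero}  φ _  = z≤n
qr-⋀ {suc b} φ qφ = ⊔-lub (qφ zero) (qr-⋀ (φ ∘ suc) (qφ ∘ suc))

member : ∀ k → Formula arity (suc k)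
member zero    = rel P (zero ∷ zero ∷ [])
member (suc k) = rel E (zero ∷ suc zero ∷ [])

-- On a membership chain y_i, y_{i+1}, …, y_q (variables 0, 1, …, k − 1, where
-- k + i = q + 1), query i k u says that u belongs to y_i; when k = 0, it says
-- that u belongs to the set S coded by P.
query : ∀ i k → Fin (#bits i k) → Formula arity k
query zero    (suc k) u =
  rel (R (proj₁ (remQuot {3} (suc k) u))) (proj₂ (remQuot {3} (suc k) u) ∷ zero ∷ [])
query (suc i) k v =
  ex (conj (member k) (⋀ λ u → lit (bit (toℕ v) (toℕ u)) (query i (suc k) u)))

qr-member : ∀ k → qr (member k) ≡ 0
qr-member zero    = refl
qr-member (suc k) = refl

qr-query : ∀ i k u → qr (query i k u) ≤ i
qr-query zero    (suc k) u = z≤n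
qr-query (suc i) k       v = s≤s (⊔-lub (≤-trans (≤-reflexive (qr-member k)) z≤n)
  (qr-⋀ _ λ u → ≤-trans (≤-reflexive (qr-lit (bit (toℕ v) (toℕ u)) _)) (qr-query i (suc k) u)))

-- The structures, and the truth of queries along chains.

module _ (q : ℕ) where

  maxValue : ℕ
  maxValue = #bits (suc q) 0

  -- Elements are all pairs of a level up to `q` and a value up to `maxValue`. The factor
  -- `suc maxValue` makes the size a successor by computation, as `EquivArith` requires.
  Universe : Set
  Universe = Fin (suc q * suc maxValue)

  level value : Universe → ℕ
  level a = toℕ (proj₁ (remQuot {suc q} (suc maxValue) a))
  value a = toℕ (proj₂ (remQuot {suc q} (suc maxValue) a))

  element : ∀ {i v} → i < suc q → v < suc maxValue → ∃ λ a → level a ≡ i × value a ≡ v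
  element i< v< = combine (fromℕ< i<) (fromℕ< v<) ,
    trans (cong (toℕ ∘ proj₁) (remQuot-combine (fromℕ< i<) (fromℕ< v<))) (toℕ-fromℕ< i<) ,
    trans (cong (toℕ ∘ proj₂) (remQuot-combine (fromℕ< i<) (fromℕ< v<))) (toℕ-fromℕ< v<)

  relations : ℕ → (s : Fin 5) → Vec Universe (arity s) → Bool
  relations S E     (z ∷ y ∷ []) = (level y ≡ᵇ suc (level z)) ∧ bit (value y) (value z)
  relations S P     (z ∷ _ ∷ []) = (level z ≡ᵇ q) ∧ bit S (value z)
  -- The atom R_s(y_j, y_0) is coded by the number (q + 1)s + j, where `y_j` enters through its
  -- level j.
  relations S (R s) (y ∷ z ∷ []) = bit (value z) (suc q * toℕ s + level y)

  structure : ℕ → Structure arity (suc q * suc maxValue)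
  structure S .ltA  a b   = ⌊ toℕ a <? toℕ b ⌋
  structure S .addA a b c = ⌊ toℕ c ≟ℕ toℕ a + toℕ b ⌋
  structure S .mulA a b c = ⌊ toℕ c ≟ℕ toℕ a * toℕ b ⌋
  structure S .relA       = relations S

  structure-arith : ∀ S → BuiltInArith (structure S)
  structure-arith S = id , (id , λ y → y , id)
    , (λ _ _ → mk⇔ toWitness fromWitness)
    , (λ _ _ _ → mk⇔ toWitness fromWitness)
    , (λ _ _ _ → mk⇔ toWitness fromWitness)

  -- The index is the level of the set to be queried next: the head of the tuple, or S, which counts
  -- as level `q + 1`.
  data Chain : ℕ → ∀ {k} → Vec Universe k → Set where
    top  : Chain (suc q) []
    step : ∀ {i k a} {ρ : Vec Universe k} → Chain (suc i) ρ → level a ≡ i → Chain i (a ∷ ρ)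

  chain-length : ∀ {i k} {ρ : Vec Universe k} → Chain i ρ → k + i ≡ suc q
  chain-length top = refl
  chain-length {i} {suc k} (step ch _) = trans (sym (+-suc k i)) (chain-length ch)

  chain-level : ∀ {i k} {ρ : Vec Universe k} → Chain i ρ → ∀ j → level (lookup ρ j) ≡ i + toℕ j
  chain-level {i} (step ch e) zero    = trans e (sym (+-identityʳ i))
  chain-level {i} (step ch e) (suc j) = trans (chain-level ch j) (sym (+-suc i (toℕ j)))

  module _ (S : ℕ) where

    current : ∀ {k} → Vec Universe k → ℕ
    current []      = S
    current (a ∷ _) = value a

    eval-member : ∀ {i k} {ρ : Vec Universe k} → Chain (suc i) ρ → ∀ a →
                  T (eval (structure S) (member k) (a ∷ ρ)) ⇔
                  (level a ≡ i × T (bit (current ρ) (value a)))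
    eval-member top a = mk⇔
      (λ t → let l , m = to T-∧ t in ≡ᵇ⇒≡ _ _ l , m)
      (λ (l , m) → from T-∧ (≡⇒≡ᵇ _ _ l , m))
      where open Equivalence
    eval-member (step _ e) a = mk⇔
      (λ t → let l , m = to T-∧ t in sym (suc-injective (trans (sym e) (≡ᵇ⇒≡ _ _ l))) , m)
      (λ (l , m) → from T-∧ (≡⇒≡ᵇ _ _ (trans e (cong suc (sym l))) , m))
      where open Equivalence

    -- Induction on the level: the bound on `current ρ` makes a member determined by its bits, and
    -- the bound by `maxValue` ensures that the described member exists.
    eval-query : ∀ i {k} {ρ : Vec Universe k} → Chain i ρ →
                 current ρ < 2 ^ #bits i k → #bits i k ≤ maxValue →
                 ∀ u → eval (structure S) (query i k u) ρ ≡ bit (current ρ) (toℕ u)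
    eval-query zero {suc k} {y ∷ ρ} ch _ _ u = cong (bit (value y)) (begin
      -- At level 0 the chain has full length `q + 1` and its j-th entry has level j.
      suc q * toℕ s + level (lookup (y ∷ ρ) j)
        ≡⟨ cong₂ (λ m l → m * toℕ s + l)
             (trans (sym (chain-length ch)) (+-identityʳ (suc k))) (chain-level ch j) ⟩
      suc k * toℕ s + toℕ j            ≡⟨ toℕ-combine s j ⟨
      toℕ (combine s j)                ≡⟨ cong toℕ (combine-remQuot {3} (suc k) u) ⟩
      toℕ u                            ∎)
      where
      open ≡-Reasoning
      s = proj₁ (remQuot {3} (suc k) u)
      j = proj₂ (remQuot {3} (suc k) u)
    eval-query (suc i) {k} {ρ} ch cur< ≤max v = T-ext ⇒ ⇐
      where
      open Equivalence
      ≤max′ : #bits i (suc k) ≤ maxValue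
      ≤max′ = ≤-trans (<⇒≤ (n<2^n (#bits i (suc k)))) ≤max
      describe : Fin (#bits i (suc k)) → Formula arity (suc k)
      describe u = lit (bit (toℕ v) (toℕ u)) (query i (suc k) u)
      ⇒ : T (eval (structure S) (query (suc i) k v) ρ) → T (bit (current ρ) (toℕ v))
      ⇒ t with any-allFin⁻ t
      ... | a , ta with to T-∧ ta
      ... | mem , desc with to (eval-member ch a) mem
      ... | la , bit-a = subst (T ∘ bit (current ρ)) value≡v bit-a
        where
        value< : value a < 2 ^ #bits i (suc k)
        value< = bit⇒< _ (value a) cur< bit-a
        -- Both numbers have at most `#bits i (suc k)` bits, and by induction the queries on `a`
        -- read off exactly those bits.
        value≡v : value a ≡ toℕ v
        value≡v = bit-injective (#bits i (suc k)) value< (toℕ<n v) λ u →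
          trans (sym (eval-query i (step ch la) value< ≤max′ u))
                (to (eval-lit (structure S) _ _ _) (to (eval-⋀ (structure S) describe (a ∷ ρ)) desc u))
      i< : i < suc q
      i< = ≤-trans (m≤n+m (suc i) k) (≤-reflexive (chain-length ch))
      ⇐ : T (bit (current ρ) (toℕ v)) → T (eval (structure S) (query (suc i) k v) ρ)
      ⇐ t with element i< (s≤s (≤-trans (<⇒≤ (toℕ<n v)) ≤max))
      ... | a , la , va = any-allFin⁺ a (from T-∧
        ( from (eval-member ch a) (la , subst (T ∘ bit (current ρ)) (sym va) t)
        , from (eval-⋀ (structure S) describe (a ∷ ρ)) λ u → from (eval-lit (structure S) _ _ _)
            (trans (eval-query i (step ch la) (subst (_< _) (sym va) (toℕ<n v)) ≤max′ u)
                   (cong (λ w → bit w (toℕ u)) va)) ))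

  -- Pigeonhole and separation.

  same-type : ∃ λ S → ∃ λ S′ → S < 2 ^ maxValue × S′ < 2 ^ maxValue × S ≢ S′ ×
              type q (structure S) [] ≡ type q (structure S′) []
  same-type with pigeonhole (#types<2^#bits q 0) (λ S → type q (structure (toℕ S)) [])
  ... | i , j , i<j , e =
    toℕ i , toℕ j , toℕ<n i , toℕ<n j , <⇒≢ i<j ∘ toℕ-injective , e

  separating-bit : ∀ {S S′} → S < 2 ^ maxValue → S′ < 2 ^ maxValue → S ≢ S′ →
                   ∃ λ (u : Fin maxValue) → bit S (toℕ u) ≢ bit S′ (toℕ u)
  separating-bit S< S′< S≢S′ =
    ¬∀⟶∃¬ maxValue _ (λ u → bit _ (toℕ u) ≟ᵇ bit _ (toℕ u))
          (S≢S′ ∘ bit-injective maxValue S< S′<)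

theorem6p1 : Σ ℕ λ m → Σ (Fin m → ℕ) λ ar →
    ∀ (q : ℕ) → Σ (Sentence ar) λ φ →
    qr φ ≤ suc q × (∀ (ψ : Sentence ar) → qr ψ ≤ q → ¬ EquivArith φ ψ)
theorem6p1 = 5 , arity , separate
  where
  separate : ∀ q → Σ (Sentence arity) λ φ →
             qr φ ≤ suc q × (∀ ψ → qr ψ ≤ q → ¬ EquivArith φ ψ)
  separate q with same-type q
  ... | S , S′ , S< , S′< , S≢S′ , same with separating-bit q S< S′< S≢S′
  -- The sentence `φ` says that `u` belongs to S; it tells the two structures apart, while `ψ`
  -- cannot.
  ... | u , bit≢ = φ , qr-query (suc q) 0 u , λ ψ qψ φ⇔ψ → bit≢ (begin
    bit S (toℕ u)               ≡⟨ eval-query q S (suc q) top S< ≤-refl u ⟨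
    eval (structure q S) φ []   ≡⟨ agree ψ φ⇔ψ S ⟩
    eval (structure q S) ψ []   ≡⟨ type⇒eval ψ q (structure q S) (structure q S′) qψ same ⟩
    eval (structure q S′) ψ []  ≡⟨ agree ψ φ⇔ψ S′ ⟨
    eval (structure q S′) φ []  ≡⟨ eval-query q S′ (suc q) top S′< ≤-refl u ⟩
    bit S′ (toℕ u)              ∎)
    where
    open ≡-Reasoning
    φ : Sentence arity
    φ = query (suc q) 0 u
    agree : ∀ ψ → EquivArith φ ψ → ∀ S → eval (structure q S) φ [] ≡ eval (structure q S) ψ []
    agree ψ φ⇔ψ S = T-ext (Equivalence.to equiv) (Equivalence.from equiv)
      where equiv = φ⇔ψ _ (structure q S) (structure-arith q S)
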